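{- Let $T$ be a monoidal monad on $\mathbf{Set}$, let $n\ge 1$, and let $\Sigma$ be a signature containing an $n$-ary operation symbol $f$. Then $T$ preserves the equation $f(x,\dots,x)=x$ if and only if $T$ is $n$-relevant.
   Context: A monoidal monad on $\mathbf{Set}$ is a monad with natural $\psi_{X,Y}\colon TX\times TY\to T(X\times Y)$ making it lax monoidal with $\psi^0=\eta_1$ and with $\eta,\mu$ monoidal; $\psi^n$ is its $n$-ary version. The lifting $\widehat T\mathcal A$ of a $\Sigma$-algebra on $A$ has carrier $TA$ and operations $T\sigma_{\mathcal A}\circ\psi^{\mathrm{ar}(\sigma)}$; $T$ preserves an equation if $\widehat T\mathcal A$ satisfies it whenever $\mathcal A$ does. $T$ is $n$-relevant if $\psi^n\circ\Delta^n_{TA}=T\Delta^n_A$ for all sets $A$, where $\Delta^n_X\colon X\to X^n$ is the diagonal (equivalently $\psi^n\circ\langle T\pi_1,\dots,T\pi_n\rangle=\mathrm{id}$). -}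

module Defs where

open import Data.Nat using (ℕ)
open import Data.Product using (_×_; _,_; proj₁; proj₂; uncurry; assocʳ′)
import Data.Product as Product
open import Data.Unit.Polymorphic using (⊤; tt)
open import Data.Vec using (Vec; []; _∷_; replicate)
open import Function using (id; _∘_)
import Level
open import Level using (Level; _⊔_)
open import Relation.Binary.PropositionalEquality using (_≡_; _≗_)

-- The category Set is rendered as the types of a universe, with functions
-- compared pointwise (_≗_).  As function extensionality is not available,
-- a functor has to respect this equality explicitly (fmap-cong).

record Monad (ℓ : Level) : Set (Level.suc ℓ) where
  field
    T : Set ℓ → Set ℓ

    fmap      : {A B : Set ℓ} → (A → B) → T A → T B
    fmap-cong : {A B : Set ℓ} {f g : A → B} → f ≗ g → fmap f ≗ fmap g
    fmap-id   : {A : Set ℓ} → fmap (id {A = A}) ≗ id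
    fmap-∘    : {A B C : Set ℓ} (g : B → C) (f : A → B) →
                fmap (g ∘ f) ≗ fmap g ∘ fmap f

    η         : {A : Set ℓ} → A → T A
    η-natural : {A B : Set ℓ} (f : A → B) → fmap f ∘ η ≗ η ∘ f

    μ         : {A : Set ℓ} → T (T A) → T A
    μ-natural : {A B : Set ℓ} (f : A → B) → fmap f ∘ μ ≗ μ ∘ fmap (fmap f)

    μ-identityˡ : {A : Set ℓ} → μ {A} ∘ η ≗ id
    μ-identityʳ : {A : Set ℓ} → μ {A} ∘ fmap η ≗ id
    μ-assoc     : {A : Set ℓ} → μ {A} ∘ μ ≗ μ ∘ fmap μ

-- The nullary structure map ψ⁰ is η at the one-element set, so the conditions
-- that η and μ be compatible with ψ⁰ are already instances of the monad laws.

record MonoidalMonad (ℓ : Level) : Set (Level.suc ℓ) where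
  field
    monad : Monad ℓ

  open Monad monad public

  ψ⁰ : T ⊤
  ψ⁰ = η tt

  field
    ψ : {A B : Set ℓ} → T A × T B → T (A × B)

    ψ-natural : {A A′ B B′ : Set ℓ} (f : A → A′) (g : B → B′) →
                fmap (Product.map f g) ∘ ψ ≗ ψ ∘ Product.map (fmap f) (fmap g)

    ψ-unitˡ : {A : Set ℓ} (t : T A) → fmap proj₂ (ψ (ψ⁰ , t)) ≡ t
    ψ-unitʳ : {A : Set ℓ} (t : T A) → fmap proj₁ (ψ (t , ψ⁰)) ≡ t
    ψ-assoc : {A B C : Set ℓ} (r : T A) (s : T B) (t : T C) →
              fmap assocʳ′ (ψ (ψ (r , s) , t)) ≡ ψ (r , ψ (s , t))

    η-monoidal : {A B : Set ℓ} (a : A) (b : B) → ψ (η a , η b) ≡ η (a , b)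
    μ-monoidal : {A B : Set ℓ} (s : T (T A)) (t : T (T B)) →
                 ψ (μ s , μ t) ≡ μ (fmap ψ (ψ (s , t)))

  -- The power Aⁿ is Vec A n, built by iterated binary products.
  ψⁿ : {A : Set ℓ} {n : ℕ} → Vec (T A) n → T (Vec A n)
  ψⁿ []       = fmap (λ _ → []) ψ⁰
  ψⁿ (t ∷ ts) = fmap (uncurry _∷_) (ψ (t , ψⁿ ts))

Δ : {a : Level} {A : Set a} (n : ℕ) → A → Vec A n
Δ n = replicate n

Relevant : {ℓ : Level} → MonoidalMonad ℓ → ℕ → Set (Level.suc ℓ)
Relevant {ℓ} M n = (A : Set ℓ) → ψⁿ ∘ Δ {A = T A} n ≗ fmap (Δ {A = A} n)
  where open MonoidalMonad M

record Signature (o : Level) : Set (Level.suc o) where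
  field
    Op    : Set o
    arity : Op → ℕ

open Signature public

record Algebra {o : Level} (S : Signature o) (ℓ : Level) : Set (o ⊔ Level.suc ℓ) where
  field
    Carrier   : Set ℓ
    interpret : (σ : Op S) → Vec Carrier (arity S σ) → Carrier

data Term {o v : Level} (S : Signature o) (V : Set v) : Set (o ⊔ v) where
  var : V → Term S V
  op  : (σ : Op S) → Vec (Term S V) (arity S σ) → Term S V

infix 4 _≈_

record Equation {o v : Level} (S : Signature o) (V : Set v) : Set (o ⊔ v) where
  constructor _≈_
  field
    lhs rhs : Term S V

module _ {o ℓ v : Level} {S : Signature o} (𝒜 : Algebra S ℓ) {V : Set v} where
  open Algebra 𝒜

  mutual
    eval : (V → Carrier) → Term S V → Carrier
    eval ρ (var x)   = ρ x
    eval ρ (op σ ts) = interpret σ (evals ρ ts)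

    evals : (V → Carrier) → {n : ℕ} → Vec (Term S V) n → Vec Carrier n
    evals ρ []       = []
    evals ρ (t ∷ ts) = eval ρ t ∷ evals ρ ts

infix 3 _⊨_

_⊨_ : {o ℓ v : Level} {S : Signature o} {V : Set v} →
      Algebra S ℓ → Equation S V → Set (ℓ ⊔ v)
_⊨_ {V = V} 𝒜 (s ≈ t) = (ρ : V → Algebra.Carrier 𝒜) → eval 𝒜 ρ s ≡ eval 𝒜 ρ t

lift-algebra : {o ℓ : Level} {S : Signature o} →
               MonoidalMonad ℓ → Algebra S ℓ → Algebra S ℓ
lift-algebra M 𝒜 = record
  { Carrier   = T Carrier
  ; interpret = λ σ → fmap (interpret σ) ∘ ψⁿ
  }
  where
    open MonoidalMonad M
    open Algebra 𝒜

Preserves : {o ℓ v : Level} {S : Signature o} {V : Set v} →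
            MonoidalMonad ℓ → Equation S V → Set (o ⊔ Level.suc ℓ ⊔ v)
Preserves {ℓ = ℓ} {S = S} M e =
  (𝒜 : Algebra S ℓ) → 𝒜 ⊨ e → lift-algebra M 𝒜 ⊨ e

idempotence : {o v : Level} {S : Signature o} {V : Set v} →
              Op S → V → Equation S V
idempotence {S = S} f x = op f (replicate (arity S f) (var x)) ≈ var x

{-# OPTIONS --safe #-}
-- If T preserves idempotence, apply it to the diagonal algebra on Aⁿ, where
-- f(v₁,…,vₙ) = (π₁v₁,…,πₙvₙ), at the element TΔ(t): by naturality of ψⁿ this
-- yields ψⁿ(t,…,t) = TΔ(t).  The nullary symbols of the signature need a point
-- of A, so A is first replaced by Maybe A; the result descends to A because a
-- function with a partial retraction is sent by T to an injection.
module Submission where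

open import Defs
open import Data.Maybe using (Maybe; just; nothing; maybe′)
import Data.Maybe.Effectful as Maybe
open import Data.Nat using (ℕ; zero; suc; _≤_)
open import Data.Product using (_,_; uncurry)
import Data.Product as Product
open import Data.Vec using (Vec; []; _∷_; map; replicate; tail)
import Data.Vec.Effectful as Vec
open import Data.Vec.Properties using (map-replicate; map-∘)
open import Function using (id; _∘_; const)
open import Function.Bundles using (_⇔_; mk⇔)
open import Level using (Level)
open import Relation.Binary.PropositionalEquality
  using (_≡_; _≗_; refl; sym; trans; cong; module ≡-Reasoning)

open ≡-Reasoning

-- Total for every k, so that it interprets the symbols of all arities at once
-- and no equality test on symbols or arities is needed.
padded-diagonal : {a : Level} {A : Set a} {n k : ℕ} →
                  A → Vec (Vec A n) k → Vec A n
padded-diagonal {n = zero}  d xss              = []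
padded-diagonal {n = suc n} d []               = replicate (suc n) d
padded-diagonal {n = suc n} d ((x ∷ _) ∷ xss) = x ∷ padded-diagonal d (map tail xss)

-- This is what makes the diagonal algebra idempotent: with as many rows as columns `d` is never
-- reached, and the tails of equal rows are again equal rows.
padded-diagonal-replicate : {a : Level} {A : Set a} {n : ℕ} (d : A) (xs : Vec A n) →
                            padded-diagonal d (replicate n xs) ≡ xs
padded-diagonal-replicate d [] = refl
padded-diagonal-replicate {n = suc n} d (x ∷ xs) = cong (x ∷_) (begin
  padded-diagonal d (map tail (replicate n (x ∷ xs)))
    ≡⟨ cong (padded-diagonal d) (map-replicate tail (x ∷ xs) n) ⟩
  padded-diagonal d (replicate n xs)
    ≡⟨ padded-diagonal-replicate d xs ⟩
  xs ∎)

-- Row i is constant at the i-th entry, so the diagonal reads the entries back. This recovers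
-- ψⁿ(t,...,t) from its image under `fmap (map (Δ n))`.
padded-diagonal-map-replicate : {a : Level} {A : Set a} {n : ℕ} (d : A) (xs : Vec A n) →
                                padded-diagonal d (map (replicate n) xs) ≡ xs
padded-diagonal-map-replicate d [] = refl
padded-diagonal-map-replicate {n = suc n} d (x ∷ xs) = cong (x ∷_) (begin
  padded-diagonal d (map tail (map (replicate (suc n)) xs))
    ≡⟨ cong (padded-diagonal d) (map-∘ tail (replicate (suc n)) xs) ⟨
  padded-diagonal d (map (replicate n) xs)
    ≡⟨ padded-diagonal-map-replicate d xs ⟩
  xs ∎)

-- Partiality is forced: for empty `A` and positive `n` there is no map at all from
-- `Vec (Maybe A) n` to `Vec A n`.
sequence : {a : Level} {A : Set a} {n : ℕ} → Vec (Maybe A) n → Maybe (Vec A n)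
sequence = Vec.TraversableA.sequenceA Maybe.applicative

sequence-map-just : {a : Level} {A : Set a} {n : ℕ} (xs : Vec A n) →
                    sequence (map just xs) ≡ just xs
sequence-map-just []       = refl
sequence-map-just (x ∷ xs) rewrite sequence-map-just xs = refl

module _ {ℓ : Level} (M : Monad ℓ) where
  open Monad M

  -- Completing `r` to a Kleisli map that is `η` along `f` gives a Kleisli extension undoing
  -- `fmap f`, by the unit law. It depends on `s` alone, so it can be applied to both sides of the
  -- equation.
  fmap-injective : {A B : Set ℓ} (f : A → B) (r : B → Maybe A) → r ∘ f ≗ just →
                   {s t : T A} → fmap f s ≡ fmap f t → s ≡ t
  fmap-injective {A} {B} f r r∘f≗just {s} {t} eq = begin
    s                     ≡⟨ retract-fmap s ⟨
    retract (fmap f s)    ≡⟨ cong retract eq ⟩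
    retract (fmap f t)    ≡⟨ retract-fmap t ⟩
    t                     ∎
    where
    -- Where r is undefined the value is s: only TA, not A, is known to have
    -- an element.
    g : B → T A
    g = maybe′ η s ∘ r

    retract : T B → T A
    retract = μ ∘ fmap g

    retract-fmap : retract ∘ fmap f ≗ id
    retract-fmap u = begin
      μ (fmap g (fmap f u))  ≡⟨ cong μ (fmap-∘ g f u) ⟨
      μ (fmap (g ∘ f) u)     ≡⟨ cong μ (fmap-cong (cong (maybe′ η s) ∘ r∘f≗just) u) ⟩
      μ (fmap η u)           ≡⟨ μ-identityʳ u ⟩
      u                      ∎

module _ {ℓ : Level} (M : MonoidalMonad ℓ) where
  open MonoidalMonad M

  ψⁿ-natural : {A B : Set ℓ} {n : ℕ} (f : A → B) (ts : Vec (T A) n) →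
               fmap (map f) (ψⁿ ts) ≡ ψⁿ (map (fmap f) ts)
  ψⁿ-natural f [] = sym (fmap-∘ (map f) (λ _ → []) ψ⁰)
  ψⁿ-natural f (t ∷ ts) = begin
    fmap (map f) (fmap (uncurry _∷_) (ψ (t , ψⁿ ts)))
      ≡⟨ fmap-∘ (map f) (uncurry _∷_) _ ⟨
    -- Definitionally the same map as `map f ∘ uncurry _∷_`.
    fmap (uncurry _∷_ ∘ Product.map f (map f)) (ψ (t , ψⁿ ts))
      ≡⟨ fmap-∘ (uncurry _∷_) (Product.map f (map f)) _ ⟩
    fmap (uncurry _∷_) (fmap (Product.map f (map f)) (ψ (t , ψⁿ ts)))
      ≡⟨ cong (fmap (uncurry _∷_)) (ψ-natural f (map f) (t , ψⁿ ts)) ⟩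
    fmap (uncurry _∷_) (ψ (fmap f t , fmap (map f) (ψⁿ ts)))
      ≡⟨ cong (λ u → fmap (uncurry _∷_) (ψ (fmap f t , u))) (ψⁿ-natural f ts) ⟩
    fmap (uncurry _∷_) (ψ (fmap f t , ψⁿ (map (fmap f) ts))) ∎

  -- Transports equal arguments along `Δ n` to reach the diagonal algebra, and along `just` to
  -- adjoin a point.
  ψⁿ-Δ-natural : {A B : Set ℓ} (n : ℕ) (f : A → B) (t : T A) →
                 fmap (map f) (ψⁿ (Δ n t)) ≡ ψⁿ (Δ n (fmap f t))
  ψⁿ-Δ-natural n f t =
    trans (ψⁿ-natural f (Δ n t)) (cong ψⁿ (map-replicate (fmap f) t n))

module _ {o ℓ v : Level} {S : Signature o} (𝒜 : Algebra S ℓ) {V : Set v} where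
  open Algebra 𝒜

  evals-replicate : (ρ : V → Carrier) (n : ℕ) (t : Term S V) →
                    evals 𝒜 ρ (replicate n t) ≡ replicate n (eval 𝒜 ρ t)
  evals-replicate ρ zero    t = refl
  evals-replicate ρ (suc n) t = cong (eval 𝒜 ρ t ∷_) (evals-replicate ρ n t)

  idempotent⇒⊨ : (f : Op S) (x : V) →
                 interpret f ∘ Δ (arity S f) ≗ id → 𝒜 ⊨ idempotence f x
  idempotent⇒⊨ f x idem ρ =
    trans (cong (interpret f) (evals-replicate ρ (arity S f) (var x))) (idem (ρ x))

  -- A constant valuation gives `x` any prescribed value without comparing variables.
  ⊨⇒idempotent : (f : Op S) (x : V) →
                 𝒜 ⊨ idempotence f x → interpret f ∘ Δ (arity S f) ≗ id
  ⊨⇒idempotent f x sat a =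
    trans (cong (interpret f) (sym (evals-replicate (const a) (arity S f) (var x))))
          (sat (const a))

-- At arity `n` this is the n-ary rectangular band on the power of `A`; symbols of smaller arity
-- fill the missing coordinates with `d`.
diagonal-algebra : {o ℓ : Level} (S : Signature o) {A : Set ℓ} → A → ℕ → Algebra S ℓ
diagonal-algebra S {A} d n = record
  { Carrier   = Vec A n
  ; interpret = λ _ → padded-diagonal d
  }

module _ {o ℓ v : Level} (M : MonoidalMonad ℓ) {S : Signature o} (f : Op S)
         {V : Set v} (x : V) where
  open MonoidalMonad M

  private
    n : ℕ
    n = arity S f

  -- Relevance turns the lifted operation on equal arguments into `fmap` of the original one
  -- composed with the diagonal, which is the identity.
  relevant⇒preserves : Relevant M n → Preserves M (idempotence {S = S} f x)
  relevant⇒preserves rel 𝒜 sat = idempotent⇒⊨ (lift-algebra M 𝒜) f x λ t → begin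
    fmap (interpret f) (ψⁿ (Δ n t))   ≡⟨ cong (fmap (interpret f)) (rel Carrier t) ⟩
    fmap (interpret f) (fmap (Δ n) t) ≡⟨ fmap-∘ (interpret f) (Δ n) t ⟨
    fmap (interpret f ∘ Δ n) t        ≡⟨ fmap-cong (⊨⇒idempotent 𝒜 f x sat) t ⟩
    fmap id t                         ≡⟨ fmap-id t ⟩
    t                                 ∎
    where open Algebra 𝒜

  preserves⇒relevant-pointed : Preserves M (idempotence {S = S} f x) →
                               {A : Set ℓ} → A → ψⁿ ∘ Δ {A = T A} n ≗ fmap (Δ {A = A} n)
  preserves⇒relevant-pointed pres {A} d t = begin
    ψⁿ (Δ n t)
      ≡⟨ fmap-id _ ⟨
    fmap id (ψⁿ (Δ n t))
      -- The identity on `Vec A n` is factored through vectors of vectors, so that the lifted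
      -- operation of `𝒟` appears.
      ≡⟨ fmap-cong (padded-diagonal-map-replicate d) _ ⟨
    fmap (padded-diagonal d ∘ map (Δ n)) (ψⁿ (Δ n t))
      ≡⟨ fmap-∘ (padded-diagonal d) (map (Δ n)) _ ⟩
    fmap (padded-diagonal d) (fmap (map (Δ n)) (ψⁿ (Δ n t)))
      ≡⟨ cong (fmap (padded-diagonal d)) (ψⁿ-Δ-natural M n (Δ n) t) ⟩
    fmap (padded-diagonal d) (ψⁿ (Δ n (fmap (Δ n) t)))
      ≡⟨ ⊨⇒idempotent (lift-algebra M 𝒟) f x (pres 𝒟 𝒟⊨idempotence) (fmap (Δ n) t) ⟩
    fmap (Δ n) t ∎
    where
    𝒟 : Algebra S ℓ
    𝒟 = diagonal-algebra S d n

    𝒟⊨idempotence : 𝒟 ⊨ idempotence f x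
    𝒟⊨idempotence = idempotent⇒⊨ 𝒟 f x (padded-diagonal-replicate d)

  preserves⇒relevant : Preserves M (idempotence {S = S} f x) → Relevant M n
  preserves⇒relevant pres A t =
    fmap-injective monad (map just) sequence sequence-map-just (begin
      fmap (map just) (ψⁿ (Δ n t))
        ≡⟨ ψⁿ-Δ-natural M n just t ⟩
      ψⁿ (Δ n (fmap just t))
        -- `nothing` is the required point, present even when `A` is empty.
        ≡⟨ preserves⇒relevant-pointed pres nothing (fmap just t) ⟩
      fmap (Δ n) (fmap just t)
        ≡⟨ fmap-∘ (Δ n) just t ⟨
      fmap (Δ n ∘ just) t
        ≡⟨ fmap-cong (λ a → map-replicate just a n) t ⟨
      fmap (map just ∘ Δ n) t
        ≡⟨ fmap-∘ (map just) (Δ n) t ⟩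
      fmap (map just) (fmap (Δ n) t) ∎)

theorem5 : {ℓ o v : Level} (M : MonoidalMonad ℓ) (n : ℕ) → 1 ≤ n →
    (S : Signature o) (f : Op S) → arity S f ≡ n →
    {V : Set v} (x : V) →
    Preserves M (idempotence {S = S} f x) ⇔ Relevant M n
theorem5 M _ _ S f refl x = mk⇔ (preserves⇒relevant M f x) (relevant⇒preserves M f x)
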